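{- Let $(a_i)_{i=1}^n$ and $(b_i)_{i=1}^n$ be two sequences of nonnegative integers such that $(a_i)_{i=1}^n$ majorizes $(b_i)_{i=1}^n$. Then $$P(a_1,a_2,\ldots,a_n)\le P(b_1,b_2,\ldots,b_n).$$
   Context: For pairwise disjoint finite sets $T_1,\dots,T_n$ with $|T_i|=t_i$, a generalized derangement (GD) is a permutation $\sigma$ of $\bigcup_{i=1}^n T_i$ such that $\sigma(a)\notin T_i$ for every $i$ and every $a\in T_i$. $P(t_1,\dots,t_n)$ denotes the number of GDs; it depends only on the sizes and is symmetric in its arguments. A sequence $(a_i)_{i=1}^n$ majorizes $(b_i)_{i=1}^n$ if $\sum_{i=1}^n a_i=\sum_{i=1}^n b_i$ and, after sorting both in nonincreasing order $a_{(1)}\ge\cdots\ge a_{(n)}$, $b_{(1)}\ge\cdots\ge b_{(n)}$, one has $\sum_{i=1}^k a_{(i)}\ge\sum_{i=1}^k b_{(i)}$ for every $k$. -}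

module Defs where

open import Data.Nat using (ℕ; zero; suc; _+_; _≤_; _≟_)
open import Data.Nat.Properties using (≤-decTotalOrder)
open import Data.Fin using (Fin; toℕ)
open import Data.List using (List; []; _∷_; length; replicate; concat; allFin; map; filter; take; reverse; lookup)
open import Data.Nat.ListAction using (sum)
import Data.List as L
open import Data.Vec using (Vec; toList)
import Data.Vec as V
open import Data.Product using (_×_; _,_)
open import Relation.Nullary using (¬_)
open import Relation.Nullary.Decidable using (Dec; yes; no; ¬?; _×-dec_; _→-dec_)
open import Relation.Binary.PropositionalEquality using (_≡_)
open import Data.List.Relation.Unary.All using (All; all?)
import Data.List.Sort ≤-decTotalOrder as Sort

-- Generalized derangements.
-- The disjoint sets T_1,…,T_n of sizes t_1,…,t_n are realised concretely:
-- the ground set is Fin N, N = t_1+…+t_n, and each position carries the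
-- label i of the block T_i it belongs to (labels listed block by block).

blockLabels : {n : ℕ} → Vec ℕ n → List (Fin n)
blockLabels t = concat (V.toList (V.tabulate (λ i → replicate (V.lookup t i) i)))

groundSize : {n : ℕ} → Vec ℕ n → ℕ
groundSize t = length (blockLabels t)

block : {n : ℕ} (t : Vec ℕ n) → Fin (groundSize t) → Fin n
block t x = lookup (blockLabels t) x

allMaps : (m k : ℕ) → List (Vec (Fin k) m)
allMaps zero    k = V.[] ∷ []
allMaps (suc m) k = L.concatMap (λ y → map (y V.∷_) (allMaps m k)) (allFin k)

-- a map Fin m → Fin m is a permutation iff it is injective (finite set)
IsPerm : {m : ℕ} → Vec (Fin m) m → Set
IsPerm {m} f = All (λ x → All (λ y → V.lookup f x ≡ V.lookup f y → x ≡ y) (allFin m)) (allFin m)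

isPerm? : {m : ℕ} (f : Vec (Fin m) m) → Dec (IsPerm f)
isPerm? {m} f = all? (λ x → all? (λ y → (V.lookup f x Data.Fin.≟ V.lookup f y) →-dec (x Data.Fin.≟ y)) (allFin m)) (allFin m)

IsDerangementCond : {n : ℕ} (t : Vec ℕ n) → Vec (Fin (groundSize t)) (groundSize t) → Set
IsDerangementCond t σ = All (λ a → ¬ (block t (V.lookup σ a) ≡ block t a)) (allFin (groundSize t))

derCond? : {n : ℕ} (t : Vec ℕ n) (σ : Vec (Fin (groundSize t)) (groundSize t)) → Dec (IsDerangementCond t σ)
derCond? t σ = all? (λ a → ¬? (block t (V.lookup σ a) Data.Fin.≟ block t a)) (allFin (groundSize t))

IsGD : {n : ℕ} (t : Vec ℕ n) → Vec (Fin (groundSize t)) (groundSize t) → Set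
IsGD t σ = IsPerm σ × IsDerangementCond t σ

isGD? : {n : ℕ} (t : Vec ℕ n) (σ : Vec (Fin (groundSize t)) (groundSize t)) → Dec (IsGD t σ)
isGD? t σ = isPerm? σ ×-dec derCond? t σ

P : {n : ℕ} → Vec ℕ n → ℕ
P t = length (filter (isGD? t) (allMaps (groundSize t) (groundSize t)))

sortDesc : List ℕ → List ℕ
sortDesc xs = reverse (Sort.sort xs)

Majorizes : {n : ℕ} → Vec ℕ n → Vec ℕ n → Set
Majorizes {n} a b =
  (sum (toList a) ≡ sum (toList b)) ×
  ((k : ℕ) → k ≤ n → sum (take k (sortDesc (toList b))) ≤ sum (take k (sortDesc (toList a))))

{-# OPTIONS --safe #-}
-- P is a permanent. Multilinearity lets one merge two blocks of sizes p and q: writing M_k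
-- for the number of k-matchings of the complete bipartite graph K_{p,q},
--   P(p, q, R) = Σ_{k,l} M_k M_l P(p + q − k − l, R),
-- where k and l count the elements sent from the first block to the second and back.
-- Moving one element from the larger block to the smaller keeps p + q and does not decrease
-- any M_k, so it does not decrease P; and majorization is generated by such moves together
-- with permutations of the blocks.
module Submission where

open import Defs
open import Data.Bool using (true; false; if_then_else_)
open import Data.Empty using (⊥)
open import Data.Fin using (Fin; zero; suc; toℕ)
import Data.Fin as Fin
import Data.Fin.Properties as Fin
open import Data.List using (List; []; _∷_; _++_; map; length; filter; concat; concatMap; replicate; reverse; allFin; tabulate; take)
open import Data.List.Membership.Propositional using (_∈_; _∉_)
open import Data.List.Properties using (map-++; map-∘; map-id; map-replicate; map-tabulate; tabulate-lookup; concat-map; unfold-reverse)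
open import Data.List.Relation.Binary.Permutation.Propositional using (_↭_; refl; prep; swap; ↭-refl; ↭-sym; ↭-trans; ↭-reflexive; ↭⇒↭ₛ) renaming (trans to ↭trans)
open import Data.List.Relation.Binary.Permutation.Propositional.Properties using (map⁺; ++⁺ˡ; ++⁺ʳ; ++-identityʳ; shift; shifts; ↭-length; ↭-reverse; All-resp-↭)
import Data.List.Relation.Binary.Permutation.Setoid.Properties as ↭ₛ
open import Data.List.Relation.Unary.All using (All; []; _∷_)
import Data.List.Relation.Unary.All as All
import Data.List.Relation.Unary.All.Properties as All
open import Data.List.Relation.Unary.AllPairs using (AllPairs; []; _∷_)
import Data.List.Relation.Unary.AllPairs.Properties as AllPairs
open import Data.List.Relation.Unary.Any using (here; there)
open import Data.List.Relation.Unary.Linked.Properties using (Linked⇒AllPairs)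
open import Data.List.Relation.Unary.Unique.Propositional.Properties using (allFin⁺)
import Data.List.Sort
open import Data.Maybe using (Maybe; just; nothing)
open import Data.Nat using (ℕ; zero; suc; pred; _+_; _*_; _∸_; _≤_; _≥_; z≤n; s≤s)
open import Data.Nat.ListAction using (sum)
open import Data.Nat.ListAction.Properties using (sum-↭; sum-++)
open import Data.Nat.Properties
open import Data.Nat.Tactic.RingSolver using (solve-∀)
open import Data.Product using (∃; _×_; _,_)
open import Data.Vec using (Vec; []; _∷_; toList)
import Data.Vec as Vec
import Data.Vec.Properties as Vec
open import Function using (_∘_; id; Injective)
open import Relation.Binary.PropositionalEquality
open import Relation.Nullary using (¬_; Dec; yes; no; does; contradiction)
open import Relation.Nullary.Decidable using (¬?; map′; dec-true; dec-false)

-- Matchings of complete bipartite graphs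

-- matchSum p q φ = Σ_k M_k φ(k), where M_k is the number of k-matchings of K_{p,q}:
-- the first of the p vertices is either unmatched or matched to one of the q.
matchSum : ℕ → ℕ → (ℕ → ℕ) → ℕ
matchSum zero    q φ = φ 0
matchSum (suc p) q φ = matchSum p q φ + q * matchSum p (pred q) (φ ∘ suc)

-- A `k`-matching exists only for `k` at most `p` and `q`. These bounds are what make the truncated
-- subtractions in the merging formula exact.
matchSum-cong : ∀ p q {φ ψ} → (∀ k → k ≤ p → k ≤ q → φ k ≡ ψ k) → matchSum p q φ ≡ matchSum p q ψ
matchSum-cong zero    q       eq = eq 0 z≤n z≤n
matchSum-cong (suc p) zero    eq = cong (_+ 0) (matchSum-cong p 0 λ k k≤p → eq k (m≤n⇒m≤1+n k≤p))
matchSum-cong (suc p) (suc q) eq = cong₂ (λ u v → u + suc q * v)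
  (matchSum-cong p (suc q) λ k k≤p → eq k (m≤n⇒m≤1+n k≤p))
  (matchSum-cong p q λ k k≤p k≤q → eq (suc k) (s≤s k≤p) (s≤s k≤q))

matchSum-mono : ∀ p q {φ ψ} → (∀ k → φ k ≤ ψ k) → matchSum p q φ ≤ matchSum p q ψ
matchSum-mono zero    q le = le 0
matchSum-mono (suc p) q le = +-mono-≤ (matchSum-mono p q le) (*-monoʳ-≤ q (matchSum-mono p (pred q) (le ∘ suc)))

-- A vertex of the other side is likewise unmatched or matched to one of the `p`. Having the
-- recursion on both sides gives the symmetry of `matchSum`.
matchSum-suc : ∀ p q φ → matchSum p (suc q) φ ≡ matchSum p q φ + p * matchSum (pred p) q (φ ∘ suc)
matchSum-suc zero    q       φ = sym (+-identityʳ _)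
matchSum-suc (suc zero) q φ = lem q (φ 0) (φ 1)
  where
  lem : ∀ q x y → x + suc q * y ≡ x + q * y + 1 * y
  lem = solve-∀
matchSum-suc (suc (suc p)) zero φ rewrite matchSum-suc (suc p) 0 φ =
  lem p (matchSum p 0 φ) (matchSum p 0 (φ ∘ suc))
  where
  lem : ∀ p x y → (x + 0) + suc p * y + 1 * (y + 0) ≡ (x + 0) + 0 + (2 + p) * (y + 0)
  lem = solve-∀
matchSum-suc (suc (suc p)) (suc q) φ
  rewrite matchSum-suc (suc p) (suc q) φ | matchSum-suc (suc p) q (φ ∘ suc) =
  lem p q (matchSum (suc p) (suc q) φ) (matchSum (suc p) q (φ ∘ suc)) (matchSum p q (φ ∘ (2 +_)))
    (matchSum p (suc q) (φ ∘ suc)) (sym (matchSum-suc (suc p) q (φ ∘ suc)))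
  where
  lem : ∀ p q x y z u → y + suc p * z ≡ u + suc q * z →
        x + suc p * u + suc (suc q) * (y + suc p * z) ≡ x + suc q * y + suc (suc p) * (y + suc p * z)
  -- In the application, `eq` equates the two expansions of `matchSum (suc p) (suc q) (φ ∘ suc)`. To
  -- use it without subtraction, the multiple of `z` that completes `u` is added on both sides and
  -- cancelled.
  lem p q x y z u eq = +-cancelʳ-≡ (suc p * (suc q * z)) _ _ (trans (l1 p q x y z u)
    (trans (cong (λ v → x + suc p * v + suc (suc q) * (y + suc p * z)) (sym eq)) (l2 p q x y z)))
    where
    l1 : ∀ p q x y z u → x + suc p * u + suc (suc q) * (y + suc p * z) + suc p * (suc q * z) ≡
         x + suc p * (u + suc q * z) + suc (suc q) * (y + suc p * z)
    l1 = solve-∀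
    l2 : ∀ p q x y z → x + suc p * (y + suc p * z) + suc (suc q) * (y + suc p * z) ≡
         x + suc q * y + suc (suc p) * (y + suc p * z) + suc p * (suc q * z)
    l2 = solve-∀

matchSum-comm : ∀ p q φ → matchSum p q φ ≡ matchSum q p φ
matchSum-comm zero    zero    φ = refl
matchSum-comm zero    (suc q) φ = trans (matchSum-comm zero q φ) (sym (+-identityʳ _))
matchSum-comm (suc p) q       φ = trans
  (cong₂ (λ u v → u + q * v) (matchSum-comm p q φ) (matchSum-comm p (pred q) (φ ∘ suc)))
  (sym (matchSum-suc q p φ))

-- Deleting the extra vertex of either graph leaves the same K_{p,q}. The matchings using that
-- vertex contribute a factor `q` on the left and `p` on the right, times sums for the same
-- comparison with both sizes lowered by one. Since `φ` is arbitrary, this bounds every M_k.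
matchSum-transfer : ∀ {p q} φ → q ≤ p → matchSum (suc p) q φ ≤ matchSum p (suc q) φ
matchSum-transfer {p} {zero} φ _ rewrite matchSum-suc p 0 φ = +-monoʳ-≤ (matchSum p 0 φ) z≤n
matchSum-transfer {suc p} {suc q} φ (s≤s q≤p) rewrite matchSum-suc (suc p) (suc q) φ =
  +-monoʳ-≤ (matchSum (suc p) (suc q) φ) (*-mono-≤ (s≤s q≤p) (matchSum-transfer (φ ∘ suc) q≤p))

-- Permanents

-- sumPicks f ys sums f y ys′ over all ways to remove one entry y from ys, leaving ys′.
sumPicks : {Y : Set} → (Y → List Y → ℕ) → List Y → ℕ
sumPicks f []       = 0
sumPicks f (y ∷ ys) = f y ys + sumPicks (λ z zs → f z (y ∷ zs)) ys

module _ {Y : Set} where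

  sumPicks-cong : {f g : Y → List Y → ℕ} (ys : List Y) →
                  (∀ y zs → y ∷ zs ↭ ys → f y zs ≡ g y zs) → sumPicks f ys ≡ sumPicks g ys
  sumPicks-cong []       eq = refl
  sumPicks-cong (y ∷ ys) eq = cong₂ _+_ (eq y ys ↭-refl)
    (sumPicks-cong ys λ z zs p → eq z (y ∷ zs) (↭-trans (swap z y ↭-refl) (prep y p)))

  sumPicks-congAll : ∀ {Q : Y → Set} {f g : Y → List Y → ℕ} ys → All Q ys →
                     (∀ y zs → Q y → f y zs ≡ g y zs) → sumPicks f ys ≡ sumPicks g ys
  sumPicks-congAll []       []       eq = refl
  sumPicks-congAll (y ∷ ys) (q ∷ qs) eq = cong₂ _+_ (eq y ys q)
    (sumPicks-congAll ys qs λ z zs → eq z (y ∷ zs))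

  sumPicks-+ : (f g : Y → List Y → ℕ) (ys : List Y) →
               sumPicks (λ y zs → f y zs + g y zs) ys ≡ sumPicks f ys + sumPicks g ys
  sumPicks-+ f g []       = refl
  sumPicks-+ f g (y ∷ ys)
    rewrite sumPicks-+ (λ z zs → f z (y ∷ zs)) (λ z zs → g z (y ∷ zs)) ys =
    lem (f y ys) (g y ys) _ _
    where
    lem : ∀ a b c d → a + b + (c + d) ≡ a + c + (b + d)
    lem = solve-∀

  *-sumPicks : ∀ c (f : Y → List Y → ℕ) (ys : List Y) →
               c * sumPicks f ys ≡ sumPicks (λ y zs → c * f y zs) ys
  *-sumPicks c f []       = *-zeroʳ c
  *-sumPicks c f (y ∷ ys) = trans (*-distribˡ-+ c (f y ys) _)
    (cong (c * f y ys +_) (*-sumPicks c (λ z zs → f z (y ∷ zs)) ys))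

  sumPicks-swap : (h : Y → Y → List Y → ℕ) (ys : List Y) →
                  sumPicks (λ y → sumPicks (h y)) ys ≡ sumPicks (λ y → sumPicks (λ z → h z y)) ys
  sumPicks-swap h []       = refl
  sumPicks-swap h (y ∷ ys)
    rewrite sumPicks-+ (λ z zs → h z y zs) (λ z zs → sumPicks (λ u us → h z u (y ∷ us)) zs) ys
          | sumPicks-+ (λ z zs → h y z zs) (λ z zs → sumPicks (λ u us → h u z (y ∷ us)) zs) ys
          | sumPicks-swap (λ z u us → h z u (y ∷ us)) ys =
    lem (sumPicks (h y) ys) (sumPicks (λ z → h z y) ys) _
    where
    lem : ∀ a b c → a + (b + c) ≡ b + (a + c)
    lem = solve-∀

  sumPicks-↭ : {f : Y → List Y → ℕ} → (∀ y {zs zs′} → zs ↭ zs′ → f y zs ≡ f y zs′) →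
               ∀ {ys ys′} → ys ↭ ys′ → sumPicks f ys ≡ sumPicks f ys′
  sumPicks-↭ resp refl       = refl
  sumPicks-↭ resp (prep y p) = cong₂ _+_ (resp y p) (sumPicks-↭ (λ z q → resp z (prep y q)) p)
  sumPicks-↭ {f} resp (swap {ys} {ys′} y z p) = trans
    (lem (f y (z ∷ ys)) (f z (y ∷ ys)) _)
    (cong₂ _+_ (resp z (prep y p)) (cong₂ _+_ (resp y (prep z p)) (trans
      (sumPicks-cong ys λ u us _ → resp u (swap y z ↭-refl))
      (sumPicks-↭ (λ u q → resp u (prep z (prep y q))) p))))
    where
    lem : ∀ a b c → a + (b + c) ≡ b + (a + c)
    lem = solve-∀
  sumPicks-↭ resp (↭trans p q) = trans (sumPicks-↭ resp p) (sumPicks-↭ resp q)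

  -- Removing any of the `q` copies leaves the same list. At `q = 0` the value of `pred` is
  -- harmless, since that term is multiplied by 0.
  sumPicks-replicate : ∀ (f : Y → List Y → ℕ) q b ys →
    sumPicks f (replicate q b ++ ys) ≡
    q * f b (replicate (pred q) b ++ ys) + sumPicks (λ z zs → f z (replicate q b ++ zs)) ys
  sumPicks-replicate f zero          b ys = refl
  sumPicks-replicate f (suc zero)    b ys = cong (_+ sumPicks (λ z zs → f z (b ∷ zs)) ys) (sym (+-identityʳ (f b ys)))
  sumPicks-replicate f (suc (suc q)) b ys = trans
    (cong (f b (b ∷ replicate q b ++ ys) +_) (sumPicks-replicate (λ z zs → f z (b ∷ zs)) (suc q) b ys))
    (sym (+-assoc (f b (b ∷ replicate q b ++ ys)) _ _))

-- Columns left over after the last row are ignored, so this is the permanent for square matrices.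
per : {X Y : Set} → (X → Y → ℕ) → List X → List Y → ℕ
per w []       ys = 1
per w (x ∷ xs) ys = sumPicks (λ y zs → w x y * per w xs zs) ys

per-map : {X Y X′ Y′ : Set} {w : X → Y → ℕ} {w′ : X′ → Y′ → ℕ} (f : X → X′) (g : Y → Y′) →
          (∀ x y → w′ (f x) (g y) ≡ w x y) → ∀ xs ys → per w′ (map f xs) (map g ys) ≡ per w xs ys
per-map {w = w} {w′} f g eq []       ys = refl
per-map {Y = Y} {Y′ = Y′} {w = w} {w′} f g eq (x ∷ xs) ys = trans
  (sumPicks-map _ ys)
  (sumPicks-cong ys λ y zs _ → cong₂ _*_ (eq x y) (per-map f g eq xs zs))
  where
  sumPicks-map : (h : Y′ → List Y′ → ℕ) → ∀ ys →
                 sumPicks h (map g ys) ≡ sumPicks (λ y zs → h (g y) (map g zs)) ys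
  sumPicks-map h []       = refl
  sumPicks-map h (y ∷ ys) = cong (h (g y) (map g ys) +_) (sumPicks-map (λ z zs → h z (g y ∷ zs)) ys)

module _ {X Y : Set} {w : X → Y → ℕ} where

  per-colPerm : ∀ xs {ys ys′} → ys ↭ ys′ → per w xs ys ≡ per w xs ys′
  per-colPerm []       p = refl
  per-colPerm (x ∷ xs) p = sumPicks-↭ (λ y q → cong (w x y *_) (per-colPerm xs q)) p

  -- Expanding along both rows sums over ordered pairs of columns; exchanging the two picks
  -- exchanges the rows.
  per-rowSwap : ∀ x x′ xs ys → per w (x ∷ x′ ∷ xs) ys ≡ per w (x′ ∷ x ∷ xs) ys
  per-rowSwap x x′ xs ys = trans
    (expand x x′)
    (trans (sumPicks-swap _ ys)
    (trans (sumPicks-cong ys λ y zs _ → sumPicks-cong zs λ z us _ → lem (w x z) (w x′ y) (per w xs us))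
    (sym (expand x′ x))))
    where
    lem : ∀ a b c → a * (b * c) ≡ b * (a * c)
    lem = solve-∀
    expand : ∀ x x′ → per w (x ∷ x′ ∷ xs) ys ≡
             sumPicks (λ y → sumPicks (λ z us → w x y * (w x′ z * per w xs us))) ys
    expand x x′ = sumPicks-cong ys λ y zs _ → *-sumPicks (w x y) _ zs

  per-rowPerm : ∀ {xs xs′} → xs ↭ xs′ → ∀ ys → per w xs ys ≡ per w xs′ ys
  per-rowPerm refl        ys = refl
  per-rowPerm (prep x p)  ys = sumPicks-cong ys λ y zs _ → cong (w x y *_) (per-rowPerm p zs)
  per-rowPerm (swap {xs} x y p) ys = trans (per-rowSwap x y xs ys)
    (sumPicks-cong ys λ u us _ → cong (w y u *_) (sumPicks-cong us λ v vs _ → cong (w x v *_) (per-rowPerm p vs)))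
  per-rowPerm (↭trans p q) ys = trans (per-rowPerm p ys) (per-rowPerm q ys)

  per-perm : ∀ {xs xs′ ys ys′} → xs ↭ xs′ → ys ↭ ys′ → per w xs ys ≡ per w xs′ ys′
  per-perm {xs′ = xs′} {ys = ys} p q = trans (per-rowPerm p ys) (per-colPerm xs′ q)

  per-replaceCols : ∀ {b d} {xs} → All (λ x → w x b ≡ w x d) xs → ∀ q ys →
                    per w xs (replicate q b ++ ys) ≡ per w xs (replicate q d ++ ys)
  per-replaceCols []         q ys = refl
  per-replaceCols {b} {d} {x ∷ xs} (eq ∷ eqs) q ys = trans
    (sumPicks-replicate _ q b ys)
    (trans (cong₂ (λ u v → q * u + v)
      (cong₂ _*_ eq (per-replaceCols eqs (pred q) ys))
      (sumPicks-cong ys λ z zs _ → cong (w x z *_) (per-replaceCols eqs q zs)))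
    (sym (sumPicks-replicate _ q d ys)))

  -- Additivity in the first row: on these columns, row `a` is row `c` plus the indicator of the
  -- `b`-columns.
  per-row-split : ∀ {a b c ys} → w a b ≡ 1 → w c b ≡ 0 → All (λ y → w a y ≡ w c y) ys → ∀ xs q →
    per w (a ∷ xs) (replicate q b ++ ys) ≡
    per w (c ∷ xs) (replicate q b ++ ys) + q * per w xs (replicate (pred q) b ++ ys)
  per-row-split {a} {b} {c} {ys} ab cb eqs xs q
    rewrite sumPicks-replicate (λ y zs → w a y * per w xs zs) q b ys
          | sumPicks-replicate (λ y zs → w c y * per w xs zs) q b ys
          | ab | cb
          | sumPicks-congAll {f = λ z zs → w a z * per w xs (replicate q b ++ zs)}
              {g = λ z zs → w c z * per w xs (replicate q b ++ zs)} ys eqs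
              (λ y zs eq → cong (_* per w xs (replicate q b ++ zs)) eq) =
    lem q (per w xs (replicate (pred q) b ++ ys)) _
    where
    lem : ∀ q u v → q * (u + 0) + v ≡ q * 0 + v + q * u
    lem = solve-∀

  -- The a-rows differ from c-rows only in the b-columns; expanding by multilinearity
  -- chooses which a-rows are matched into b-columns.
  per-matchSum : ∀ {a b c d} → w a b ≡ 1 → w c b ≡ 0 → w c d ≡ 0 → ∀ p q {xs ys} →
    All (λ y → w a y ≡ w c y) ys → All (λ x → w x b ≡ w x d) xs →
    per w (replicate p a ++ xs) (replicate q b ++ ys) ≡
    matchSum p q λ k → per w (replicate (p ∸ k) c ++ xs) (replicate (q ∸ k) d ++ ys)
  per-matchSum ab cb cd zero    q {ys = ys} ays xbd = per-replaceCols xbd q ys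
  per-matchSum {a} {b} {c} {d} ab cb cd (suc p) q {xs} {ys} ays xbd = trans
    (per-row-split ab cb ays (replicate p a ++ xs) q)
    (cong₂ _+_
      -- A row not matched into a `b`-column becomes a `c`-row and joins `xs`, where it is
      -- admissible because its entries at `b` and `d` are both 0.
      (trans (per-rowPerm (↭-sym (shift c (replicate p a) xs)) (replicate q b ++ ys))
      (trans (per-matchSum ab cb cd p q ays (trans cb (sym cd) ∷ xbd))
      (matchSum-cong p q λ k k≤p _ → trans
        (per-rowPerm (shift c (replicate (p ∸ k) c) xs) (replicate (q ∸ k) d ++ ys))
        (cong (λ r → per w (replicate r c ++ xs) (replicate (q ∸ k) d ++ ys)) (sym (+-∸-assoc 1 k≤p))))))
      (cong (q *_) (trans (per-matchSum ab cb cd p (pred q) ays xbd)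
        (matchSum-cong p (pred q) λ k _ _ →
          cong (λ r → per w (replicate (p ∸ k) c ++ xs) (replicate r d ++ ys)) (pred∸ q k)))))
    where
    pred∸ : ∀ q k → pred q ∸ k ≡ q ∸ suc k
    pred∸ zero    k = 0∸n≡0 k
    pred∸ (suc q) k = refl

-- Merging two blocks

-- Structural recursion lets entries at partly known labels compute, so the conditions on blocks 0
-- and 1 in `gd-merge` hold by `refl`.
neq : ℕ → ℕ → ℕ
neq zero    zero    = 0
neq zero    (suc _) = 1
neq (suc _) zero    = 1
neq (suc i) (suc j) = neq i j

labels : List ℕ → List ℕ
labels []       = []
labels (p ∷ ps) = replicate p 0 ++ map suc (labels ps)

gd : List ℕ → ℕ
gd ps = per neq (labels ps) (labels ps)

neq-refl : ∀ i → neq i i ≡ 0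
neq-refl zero    = refl
neq-refl (suc i) = neq-refl i

neq-≢ : ∀ {i j} → i ≢ j → neq i j ≡ 1
neq-≢ {zero}  {zero}  i≢j with () ← i≢j refl
neq-≢ {zero}  {suc _} i≢j = refl
neq-≢ {suc _} {zero}  i≢j = refl
neq-≢ {suc i} {suc j} i≢j = neq-≢ (i≢j ∘ cong suc)

-- The label nothing marks a merged block that replaces blocks 0 and 1.
merged : ℕ → ℕ
merged 0 = 0
merged 1 = 0
merged (suc (suc _)) = 1

neq₊ : Maybe ℕ → Maybe ℕ → ℕ
neq₊ nothing  nothing  = 0
neq₊ nothing  (just j) = merged j
neq₊ (just i) nothing  = merged i
neq₊ (just i) (just j) = neq i j

others : List ℕ → List (Maybe ℕ)
others R = map (just ∘ (2 +_)) (labels R)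

others-All : {Q : Maybe ℕ → Set} (R : List ℕ) → (∀ j → Q (just (2 + j))) → All Q (others R)
others-All R h = All.map⁺ (All.universal h (labels R))

mergedGD : List ℕ → ℕ → ℕ
mergedGD R s = per neq₊ (replicate s nothing ++ others R) (replicate s nothing ++ others R)

map-just-labels : ∀ p q R → map just (labels (p ∷ q ∷ R)) ≡ replicate p (just 0) ++ replicate q (just 1) ++ others R
map-just-labels p q R = trans (map-++ just (replicate p 0) _)
  (cong₂ _++_ (map-replicate just p 0)
    (trans (sym (map-∘ (replicate q 0 ++ map suc (labels R))))
    (trans (map-++ (just ∘ suc) (replicate q 0) _)
    (cong₂ _++_ (map-replicate (just ∘ suc) q 0) (sym (map-∘ (labels R)))))))

replicate-++ : {A : Set} (m n : ℕ) (x : A) (xs : List A) →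
               replicate m x ++ replicate n x ++ xs ≡ replicate (m + n) x ++ xs
replicate-++ zero    n x xs = refl
replicate-++ (suc m) n x xs = cong (x ∷_) (replicate-++ m n x xs)

-- `per-matchSum` is applied twice: to the rows of block 0 against the columns of block 1, then the
-- other way round. Rows and columns left unmatched receive the label `nothing`.
gd-merge : ∀ p q R → gd (p ∷ q ∷ R) ≡
           matchSum p q λ k → matchSum q p λ l → mergedGD R (p + q ∸ (k + l))
gd-merge p q R = trans
  (sym (per-map just just (λ _ _ → refl) (labels (p ∷ q ∷ R)) (labels (p ∷ q ∷ R))))
  (trans (cong₂ (per neq₊) (map-just-labels p q R) (map-just-labels p q R))
  -- The columns of block 1 come first, facing the rows of block 0.
  (trans (per-colPerm {w = neq₊} (A p ++ B q ++ O) (shifts (A p) (B q)))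
  (trans (per-matchSum {w = neq₊} {a = just 0} {c = nothing} refl refl refl p q
    (All.++⁺ (All.replicate⁺ p refl) (others-All R λ _ → refl))
    (All.++⁺ (All.replicate⁺ q refl) (others-All R λ _ → refl)))
  (matchSum-cong p q λ k k≤p k≤q → trans
    -- Now the rows of block 1 and the columns of block 0 come first; the `nothing` entries join the
    -- rest.
    (per-perm (shifts (C (p ∸ k)) (B q)) (shifts (C (q ∸ k)) (A p)))
    (trans (per-matchSum {w = neq₊} {a = just 1} {c = nothing} refl refl refl q p
      (All.++⁺ (All.replicate⁺ (q ∸ k) refl) (others-All R λ _ → refl))
      (All.++⁺ (All.replicate⁺ (p ∸ k) refl) (others-All R λ _ → refl)))
    (matchSum-cong q p λ l l≤q l≤p → cong₂ (per neq₊)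
      (trans (replicate-++ (q ∸ l) (p ∸ k) nothing O)
        (cong (λ s → C s ++ O) (trans (+-comm (q ∸ l) (p ∸ k)) (∸-+ k≤p l≤q))))
      (trans (replicate-++ (p ∸ l) (q ∸ k) nothing O)
        (cong (λ s → C s ++ O) (trans (∸-+ l≤p k≤q) (cong (p + q ∸_) (+-comm l k)))))))))))
  where
  A B C : ℕ → List (Maybe ℕ)
  A n = replicate n (just 0)
  B n = replicate n (just 1)
  C n = replicate n nothing
  O = others R
  ∸-+ : ∀ {m n k l} → k ≤ m → l ≤ n → (m ∸ k) + (n ∸ l) ≡ m + n ∸ (k + l)
  ∸-+ {m} {n} {k} {l} k≤m l≤n = trans (sym (+-∸-assoc (m ∸ k) l≤n))
    (trans (cong (_∸ l) (sym (+-∸-comm n k≤m))) (∸-+-assoc (m + n) k l))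

gd-transfer : ∀ {p q} R → q ≤ p → gd (suc p ∷ q ∷ R) ≤ gd (p ∷ suc q ∷ R)
gd-transfer {p} {q} R q≤p
  rewrite gd-merge (suc p) q R | gd-merge p (suc q) R | +-suc p q = ≤-trans
  (matchSum-transfer _ q≤p)
  -- The inner sum has its sides in the opposite order, so symmetry is applied before and after the
  -- transfer.
  (matchSum-mono p (suc q) λ k → ≤-trans (≤-reflexive (matchSum-comm q (suc p) _))
    (≤-trans (matchSum-transfer _ q≤p) (≤-reflexive (matchSum-comm p (suc q) _))))

-- Invariance under reordering the blocks

record Relabelling (xs ys : List ℕ) : Set where
  constructor relabelling
  field
    f           : ℕ → ℕ
    f-injective : Injective _≡_ _≡_ f
    f-↭         : map f xs ↭ ys

-- Reordering the blocks both renames the labels and moves their positions. The renaming is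
-- injective, hence preserves `neq`, and the permanent ignores positions.
labels-↭ : ∀ {ps qs} → ps ↭ qs → Relabelling (labels ps) (labels qs)
labels-↭ {ps} refl = relabelling id id (↭-reflexive (map-id (labels ps)))
labels-↭ (prep {ps} {qs} p π) with labels-↭ π
... | relabelling f inj eq = relabelling f′ inj′ (↭-trans
  (↭-reflexive (trans (map-++ f′ (replicate p 0) _) (cong₂ _++_ (map-replicate f′ p 0)
    (trans (sym (map-∘ (labels ps))) (map-∘ (labels ps))))))
  (++⁺ˡ (replicate p 0) (map⁺ suc eq)))
  where
  f′ : ℕ → ℕ
  f′ zero    = zero
  f′ (suc i) = suc (f i)
  inj′ : Injective _≡_ _≡_ f′
  inj′ {zero}  {zero}  _ = refl
  inj′ {suc i} {suc j} e = cong suc (inj (suc-injective e))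
labels-↭ (swap {ps} {qs} p q π) with labels-↭ π
... | relabelling f inj eq = relabelling f′ inj′ (↭-trans
  (↭-reflexive (trans (map-++ f′ (replicate p 0) _) (cong₂ _++_ (map-replicate f′ p 0)
    (trans (sym (map-∘ (replicate q 0 ++ map suc (labels ps))))
    (trans (map-++ (f′ ∘ suc) (replicate q 0) _)
    (cong₂ _++_ (map-replicate (f′ ∘ suc) q 0)
      (trans (sym (map-∘ (labels ps))) (map-∘ (labels ps)))))))))
  (↭-trans (shifts (replicate p 1) (replicate q 0))
  (++⁺ˡ (replicate q 0) (↭-trans (++⁺ˡ (replicate p 1) (map⁺ (2 +_) eq))
    (↭-reflexive (sym (trans (map-++ suc (replicate p 0) _)
      (cong₂ _++_ (map-replicate suc p 0) (sym (map-∘ (labels qs)))))))))))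
  where
  f′ : ℕ → ℕ
  f′ zero          = 1
  f′ (suc zero)    = 0
  f′ (suc (suc i)) = suc (suc (f i))
  inj′ : Injective _≡_ _≡_ f′
  inj′ {zero}        {zero}        _ = refl
  inj′ {suc zero}    {suc zero}    _ = refl
  inj′ {suc (suc i)} {suc (suc j)} e = cong (2 +_) (inj (suc-injective (suc-injective e)))
  inj′ {suc zero} {zero} ()
  inj′ {suc (suc i)} {zero} ()
  inj′ {zero} {suc zero} ()
  inj′ {zero} {suc (suc i)} ()
labels-↭ (↭trans {ps} π ρ) with labels-↭ π | labels-↭ ρ
... | relabelling f injf eqf | relabelling g injg eqg =
  relabelling (g ∘ f) (injf ∘ injg) (↭-trans (↭-reflexive (map-∘ (labels ps))) (↭-trans (map⁺ g eqf) eqg))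

gd-↭ : ∀ {ps qs} → ps ↭ qs → gd ps ≡ gd qs
gd-↭ {ps} {qs} π with labels-↭ π
... | relabelling f inj eq = trans (sym (per-map f f neq-f (labels ps) (labels ps))) (per-perm eq eq)
  where
  neq-f : ∀ i j → neq (f i) (f j) ≡ neq i j
  neq-f i j with i ≟ j
  ... | yes refl = trans (neq-refl (f i)) (sym (neq-refl i))
  ... | no i≢j = trans (neq-≢ (i≢j ∘ inj)) (sym (neq-≢ i≢j))

-- Majorization by unit transfers

module Sort = Data.List.Sort ≤-decTotalOrder

infix 4 _⊒_
-- Transfers act only on the first two entries; `perm` brings any other pair to the front.
data _⊒_ : List ℕ → List ℕ → Set where
  perm     : ∀ {as bs} → as ↭ bs → as ⊒ bs
  transfer : ∀ {p q} R → q ≤ p → suc p ∷ q ∷ R ⊒ p ∷ suc q ∷ R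
  ⊒-trans  : ∀ {as bs cs} → as ⊒ bs → bs ⊒ cs → as ⊒ cs

gd-⊒ : ∀ {as bs} → as ⊒ bs → gd as ≤ gd bs
gd-⊒ (perm π)         = ≤-reflexive (gd-↭ π)
gd-⊒ (transfer R q≤p) = gd-transfer R q≤p
gd-⊒ (⊒-trans s t)    = ≤-trans (gd-⊒ s) (gd-⊒ t)

⊒-prep : ∀ x {as bs} → as ⊒ bs → x ∷ as ⊒ x ∷ bs
⊒-prep x (perm π) = perm (prep x π)
⊒-prep x (transfer {p} {q} R q≤p) = ⊒-trans (perm (rot x (suc p) q))
  (⊒-trans (transfer (x ∷ R) q≤p) (perm (↭-sym (rot x p (suc q)))))
  where
  rot : ∀ x y z → x ∷ y ∷ z ∷ R ↭ y ∷ z ∷ x ∷ R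
  rot x y z = ↭-trans (swap x y ↭-refl) (prep y (swap x z ↭-refl))
⊒-prep x (⊒-trans s t) = ⊒-trans (⊒-prep x s) (⊒-prep x t)

-- The receiver ends at `q + δ`, which is at most `x`, so it never overtakes the donor and each unit
-- transfer is legal.
⊒-move : ∀ {x q} δ R → q + δ ≤ x → x + δ ∷ q ∷ R ⊒ x ∷ q + δ ∷ R
⊒-move {x} {q} zero    R q≤x rewrite +-identityʳ x | +-identityʳ q = perm ↭-refl
⊒-move {x} {q} (suc δ) R q≤x rewrite +-suc x δ | +-suc q δ =
  ⊒-trans (transfer R (≤-trans (m≤m+n q δ) (≤-trans (n≤1+n _) (≤-trans q≤x (m≤m+n x δ)))))
          (⊒-move δ R q≤x)

-- Every prefix sum of as, increased by e, is at least the corresponding prefix sum of bs,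
-- with equality for the total.
Dom : ℕ → List ℕ → List ℕ → Set
Dom e (a ∷ as) (b ∷ bs) = b ≤ e + a × Dom (e + a ∸ b) as bs
Dom e []       []       = e ≡ 0
Dom e _        _        = ⊥

-- The surplus d of an entry x + d is handed to the first entries of as that are
-- still short of bs after the surplus e has been used.
fill : ∀ x d e as bs → All (_≤ x) bs → Dom (d + e) as bs →
       ∃ λ as′ → (x + d ∷ as ⊒ x ∷ as′) × Dom e as′ bs
fill x zero    e [] [] _ dom rewrite +-identityʳ x = [] , perm ↭-refl , dom
fill x (suc d) e [] [] _ ()
fill x d e (a ∷ as) (b ∷ bs) (b≤x ∷ bs≤x) (le , dom) with b ≤? e + a
-- The surplus `e` already covers `b`: the entry `a` stays, and all of `d` is carried further.
... | yes b≤ with fill x d (e + a ∸ b) as bs bs≤x (subst (λ s → Dom s as bs) eq dom)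
  where
  eq : d + e + a ∸ b ≡ d + (e + a ∸ b)
  eq = trans (cong (_∸ b) (+-assoc d e a)) (+-∸-assoc d b≤)
... | as′ , step , dom′ =
  a ∷ as′ , ⊒-trans (perm (swap _ a ↭-refl)) (⊒-trans (⊒-prep a step) (perm (swap a x ↭-refl))) , b≤ , dom′
fill x d e (a ∷ as) (b ∷ bs) (b≤x ∷ bs≤x) (le , dom) | no b≰
  -- `δ` is the shortfall of `e + a` below `b`, and `d′` is what remains of `d` after paying it.
  with δ , b≡ ← m≤n⇒∃[o]m+o≡n (<⇒≤ (≰⇒> b≰))
  with d′ , d≡ ← m≤n⇒∃[o]m+o≡n (+-cancelˡ-≤ (e + a) δ d (≤-trans (≤-reflexive b≡)
         (≤-trans le (≤-reflexive (trans (+-assoc d e a) (+-comm d (e + a)))))))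
  with refl ← b≡ | refl ← d≡
  -- The prefix is now level with that of `bs`, so the surplus restarts at 0.
  with fill x d′ 0 as bs bs≤x (subst (λ s → Dom s as bs) eq dom)
  where
  eq : δ + d′ + e + a ∸ (e + a + δ) ≡ d′ + 0
  eq = trans (cong (_∸ (e + a + δ)) (lem δ d′ e a)) (trans (m+n∸m≡n (e + a + δ) d′) (sym (+-identityʳ d′)))
    where
    lem : ∀ δ d e a → δ + d + e + a ≡ e + a + δ + d
    lem = solve-∀
... | as′ , step , dom′ = a + δ ∷ as′ ,
  ⊒-trans (subst (λ s → s ∷ a ∷ as ⊒ x + d′ ∷ a + δ ∷ as)
            (trans (+-assoc x d′ δ) (cong (x +_) (+-comm d′ δ)))
            -- The receiver ends at `a + δ`, which is at most `b` and hence at most `x`.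
            (⊒-move δ as (≤-trans (+-monoˡ-≤ δ (m≤n+m a e)) (≤-trans b≤x (m≤m+n x d′)))))
    (⊒-trans (perm (swap _ (a + δ) ↭-refl))
    (⊒-trans (⊒-prep (a + δ) step) (perm (swap (a + δ) x ↭-refl)))) ,
  ≤-reflexive (+-assoc e a δ) ,
  subst (λ s → Dom s as′ bs) (sym (m≤n⇒m∸n≡0 (≤-reflexive (sym (+-assoc e a δ))))) dom′

-- Entries are settled from the left: `fill` hands the excess of `a` over `b` to later entries. The
-- descending order of `bs` supplies its bound by `b`.
Dom⇒⊒ : ∀ as bs → AllPairs _≥_ bs → Dom 0 as bs → as ⊒ bs
Dom⇒⊒ []       []       _ _ = perm ↭-refl
Dom⇒⊒ (a ∷ as) (b ∷ bs) (b≥ ∷ desc) (b≤a , dom)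
  with as′ , step , dom′ ← fill b (a ∸ b) 0 as bs b≥
         (subst (λ s → Dom s as bs) (sym (+-identityʳ (a ∸ b))) dom) =
  ⊒-trans (subst (λ s → s ∷ as ⊒ b ∷ as′) (m+[n∸m]≡n b≤a) step) (⊒-prep b (Dom⇒⊒ as′ bs desc dom′))

-- Removing both heads turns the surplus into `e + a ∸ b`, and the prefix inequality at `suc k` into
-- the one at `k` for the tails.
prefixes⇒Dom : ∀ e as bs → length as ≡ length bs → e + sum as ≡ sum bs →
               (∀ k → k ≤ length bs → sum (take k bs) ≤ e + sum (take k as)) → Dom e as bs
prefixes⇒Dom e []       []       _   eq _  = trans (sym (+-identityʳ e)) eq
prefixes⇒Dom e (a ∷ as) (b ∷ bs) len eq le = b≤ , prefixes⇒Dom (e + a ∸ b) as bs (suc-injective len)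
  (trans (sym (+-∸-comm (sum as) b≤))
    (trans (cong (_∸ b) (trans (+-assoc e a (sum as)) eq)) (m+n∸m≡n b (sum bs))))
  λ k k≤ → subst (sum (take k bs) ≤_) (+-∸-comm (sum (take k as)) b≤)
    (m+n≤o⇒m≤o∸n (sum (take k bs)) (≤-trans (≤-reflexive (+-comm (sum (take k bs)) b))
      (≤-trans (le (suc k) (s≤s k≤)) (≤-reflexive (sym (+-assoc e a (sum (take k as))))))))
  where
  b≤ : b ≤ e + a
  -- This is the prefix inequality at `k = 1`.
  b≤ = ≤-trans (≤-reflexive (sym (+-identityʳ b))) (≤-trans (le 1 (s≤s z≤n)) (≤-reflexive (cong (e +_) (+-identityʳ a))))

reverse-desc : ∀ {xs} → AllPairs _≤_ xs → AllPairs _≥_ (reverse xs)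
reverse-desc []                  = []
reverse-desc {x ∷ xs} (x≤ ∷ asc) rewrite unfold-reverse x xs = AllPairs.++⁺ (reverse-desc asc) ([] ∷ [])
  (All.map (_∷ []) (All-resp-↭ (↭-sym (↭-reverse xs)) x≤))

sortDesc-↭ : ∀ xs → sortDesc xs ↭ xs
sortDesc-↭ xs = ↭-trans (↭-reverse (Sort.sort xs)) (Sort.sort-↭ xs)

sortDesc-desc : ∀ xs → AllPairs _≥_ (sortDesc xs)
sortDesc-desc xs = reverse-desc (Linked⇒AllPairs ≤-trans (Sort.sort-↗ xs))

Majorizes⇒⊒ : ∀ {n} (a b : Vec ℕ n) → Majorizes a b → toList a ⊒ toList b
Majorizes⇒⊒ {n} a b (eq , le) = ⊒-trans (perm (↭-sym (sortDesc-↭ (toList a))))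
  (⊒-trans (Dom⇒⊒ _ _ (sortDesc-desc (toList b)) (prefixes⇒Dom 0 _ _ (trans (len a) (sym (len b)))
      (trans (sum-↭ (sortDesc-↭ (toList a))) (trans eq (sym (sum-↭ (sortDesc-↭ (toList b))))))
      λ k k≤ → le k (≤-trans k≤ (≤-reflexive (len b)))))
    (perm (sortDesc-↭ (toList b))))
  where
  len : (c : Vec ℕ n) → length (sortDesc (toList c)) ≡ n
  len c = trans (↭-length (sortDesc-↭ (toList c))) (Vec.length-toList c)

-- P as a permanent

indicator : {A : Set} → Dec A → ℕ
indicator d = if does d then 1 else 0

indicator-⇔ : {A B : Set} (a : Dec A) (b : Dec B) → (A → B) → (B → A) → indicator a ≡ indicator b
indicator-⇔ (yes a) b f g rewrite dec-true b (f a) = refl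
indicator-⇔ (no ¬a) b f g rewrite dec-false b (¬a ∘ g) = refl

sumOver : {A : Set} → (A → ℕ) → List A → ℕ
sumOver f xs = sum (map f xs)

module _ {A : Set} where

  sumOver-cong : {f g : A → ℕ} → (∀ x → f x ≡ g x) → ∀ xs → sumOver f xs ≡ sumOver g xs
  sumOver-cong eq []       = refl
  sumOver-cong eq (x ∷ xs) = cong₂ _+_ (eq x) (sumOver-cong eq xs)

  sumOver-++ : (f : A → ℕ) → ∀ xs ys → sumOver f (xs ++ ys) ≡ sumOver f xs + sumOver f ys
  sumOver-++ f xs ys = trans (cong sum (map-++ f xs ys)) (sum-++ (map f xs) (map f ys))

  sumOver-0 : {f : A → ℕ} → ∀ {xs} → All (λ x → f x ≡ 0) xs → sumOver f xs ≡ 0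
  sumOver-0 []         = refl
  sumOver-0 (eq ∷ eqs) = cong₂ _+_ eq (sumOver-0 eqs)

  *-sumOver : ∀ c (f : A → ℕ) xs → sumOver (λ x → c * f x) xs ≡ c * sumOver f xs
  *-sumOver c f []       = sym (*-zeroʳ c)
  *-sumOver c f (x ∷ xs) = trans (cong (c * f x +_) (*-sumOver c f xs)) (sym (*-distribˡ-+ c (f x) _))

  sumOver≡sumPicks : (f : A → ℕ) → ∀ xs → sumOver f xs ≡ sumPicks (λ x _ → f x) xs
  sumOver≡sumPicks f []       = refl
  sumOver≡sumPicks f (x ∷ xs) = cong (f x +_) (sumOver≡sumPicks f xs)

  sumOver-concatMap : {B : Set} (f : A → ℕ) (g : B → List A) → ∀ ys →
                      sumOver f (concatMap g ys) ≡ sumOver (λ y → sumOver f (g y)) ys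
  sumOver-concatMap f g []       = refl
  sumOver-concatMap f g (y ∷ ys) = trans (sumOver-++ f (g y) (concatMap g ys))
    (cong (sumOver f (g y) +_) (sumOver-concatMap f g ys))

  length-filter≡sumOver : {P : A → Set} (P? : ∀ x → Dec (P x)) → ∀ xs →
                          length (filter P? xs) ≡ sumOver (indicator ∘ P?) xs
  length-filter≡sumOver P? [] = refl
  length-filter≡sumOver P? (x ∷ xs) with does (P? x)
  ... | true  = cong suc (length-filter≡sumOver P? xs)
  ... | false = length-filter≡sumOver P? xs

-- Counting restricted injections row by row

module _ {X : Set} {k : ℕ} {Ok : X → Fin k → Set} (ok? : ∀ x y → Dec (Ok x y)) where

  open import Data.List.Membership.DecPropositional (Fin._≟_ {k}) using (_∈?_)

  weight : ∀ {m} → (Fin m → X) → List (Fin k) → Vec (Fin k) m → ℕ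
  weight r used []      = 1
  weight r used (y ∷ f) =
    indicator (¬? (y ∈? used)) * indicator (ok? (r zero) y) * weight (r ∘ suc) (y ∷ used) f

  -- The list `used` of forbidden values makes the condition inductive in the rows; generalized
  -- derangements are the case `used = []`, `r = id`.
  record Good {m} (r : Fin m → X) (used : List (Fin k)) (f : Vec (Fin k) m) : Set where
    constructor good
    field
      fresh     : ∀ i → Vec.lookup f i ∉ used
      injective : ∀ i j → Vec.lookup f i ≡ Vec.lookup f j → i ≡ j
      allowed   : ∀ i → Ok (r i) (Vec.lookup f i)

  module _ {m} {r : Fin (suc m) → X} {used : List (Fin k)} {y : Fin k} {f : Vec (Fin k) m} where

    good-∷ : y ∉ used → Ok (r zero) y → Good (r ∘ suc) (y ∷ used) f → Good r used (y ∷ f)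
    good-∷ y∉ ok (good fresh inj allowed) = good
      (λ { zero → y∉ ; (suc i) → fresh i ∘ there })
      (λ { zero zero _ → refl
         ; zero (suc j) e → contradiction (here (sym e)) (fresh j)
         ; (suc i) zero e → contradiction (here e) (fresh i)
         ; (suc i) (suc j) e → cong suc (inj i j e) })
      (λ { zero → ok ; (suc i) → allowed i })

    good-tail : Good r used (y ∷ f) → Good (r ∘ suc) (y ∷ used) f
    good-tail (good fresh inj allowed) = good
      (λ { i (here e) → contradiction (inj (suc i) zero e) λ () ; i (there y∈) → fresh (suc i) y∈ })
      (λ i j e → Fin.suc-injective (inj (suc i) (suc j) e))
      (allowed ∘ suc)

  -- Quantifying over the decision `d` lets the induction continue with a decision for the tail
  -- obtained from `d` itself.
  indicator-good : ∀ {m} (r : Fin m → X) used f (d : Dec (Good r used f)) → indicator d ≡ weight r used f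
  indicator-good r used []      d rewrite dec-true d (good (λ ()) (λ ()) (λ ())) = refl
  indicator-good r used (y ∷ f) d with y ∈? used | ok? (r zero) y
  ... | yes y∈ | _     rewrite dec-false d (λ g → Good.fresh g zero y∈) = refl
  ... | no y∉  | no ¬ok rewrite dec-false d (λ g → ¬ok (Good.allowed g zero)) = refl
  ... | no y∉  | yes ok = trans
    (indicator-⇔ d d′ good-tail (good-∷ y∉ ok))
    (trans (indicator-good (r ∘ suc) (y ∷ used) f d′) (sym (*-identityˡ _)))
    where
    d′ : Dec (Good (r ∘ suc) (y ∷ used) f)
    d′ = map′ good-tail (good-∷ y∉ ok) d

  private
    w : X → Fin k → ℕ
    w x y = indicator (ok? x y)

  -- The invariant says that `ys` lists exactly the values not yet used. Used values contribute 0,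
  -- so summing over the next value is the expansion of the permanent along its row.
  sumOver-weight : ∀ m (r : Fin m → X) ys used → ys ++ used ↭ allFin k →
    sumOver (weight r used) (allMaps m k) ≡ per w (tabulate r) ys
  sumOver-weight zero    r ys used π = refl
  sumOver-weight (suc m) r ys used π = begin
    sumOver (weight r used) (allMaps (suc m) k)
      ≡⟨ sumOver-concatMap (weight r used) (λ y → map (y ∷_) (allMaps m k)) (allFin k) ⟩
    sumOver (λ y → sumOver (weight r used) (map (y ∷_) (allMaps m k))) (allFin k)
      ≡⟨ sumOver-cong (λ y → trans (cong sum (sym (map-∘ (allMaps m k))))
           (*-sumOver (c y) (weight (r ∘ suc) (y ∷ used)) (allMaps m k))) (allFin k) ⟩
    sumOver g (allFin k)
      ≡⟨ sum-↭ (map⁺ g (↭-sym π)) ⟩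
    sumOver g (ys ++ used)
      ≡⟨ sumOver-++ g ys used ⟩
    sumOver g ys + sumOver g used
      ≡⟨ cong₂ _+_ (sumOver≡sumPicks g ys) (sumOver-0 (All.tabulate g-used)) ⟩
    sumPicks (λ y _ → g y) ys + 0
      ≡⟨ +-identityʳ _ ⟩
    sumPicks (λ y _ → g y) ys
      ≡⟨ sumPicks-cong ys step ⟩
    per w (tabulate r) ys ∎
    where
    open ≡-Reasoning
    c g : Fin k → ℕ
    c y = indicator (¬? (y ∈? used)) * indicator (ok? (r zero) y)
    g y = c y * sumOver (weight (r ∘ suc) (y ∷ used)) (allMaps m k)
    g-used : ∀ {y} → y ∈ used → g y ≡ 0
    g-used {y} y∈ with y ∈? used
    ... | yes _ = refl
    ... | no y∉ = contradiction y∈ y∉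
    step : ∀ y zs → y ∷ zs ↭ ys → g y ≡ indicator (ok? (r zero) y) * per w (tabulate (r ∘ suc)) zs
    step y zs ρ with y ∈? used
    ... | no y∉ = cong₂ _*_ (+-identityʳ (indicator (ok? (r zero) y)))
      (sumOver-weight m (r ∘ suc) zs (y ∷ used) (↭-trans (shift y zs used) (↭-trans (++⁺ʳ used ρ) π)))
    -- This case is impossible: `y ∷ zs ++ used` reorders `allFin k`, which has no repetitions.
    ... | yes y∈ with y≢ ∷ _ ← ↭ₛ.Unique-resp-↭ (setoid (Fin k))
           (↭⇒↭ₛ (↭-sym (↭-trans (++⁺ʳ used ρ) π))) (allFin⁺ k) =
      contradiction refl (All.lookup (All.++⁻ʳ zs y≢) y∈)

toℕ-blockLabels : ∀ {n} (t : Vec ℕ n) → map toℕ (blockLabels t) ≡ labels (toList t)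
toℕ-blockLabels []      = refl
toℕ-blockLabels {suc n} (p ∷ t) = trans (map-++ toℕ (replicate p zero) _)
  (cong₂ _++_ (map-replicate toℕ p zero) (begin
    map toℕ (concat (Vec.toList (Vec.tabulate (λ i → replicate (Vec.lookup t i) (suc i)))))
      ≡⟨ cong (map toℕ ∘ concat) (trans (cong Vec.toList (trans
           (Vec.tabulate-cong λ i → sym (map-replicate suc (Vec.lookup t i) i))
           (Vec.tabulate-∘ (map suc) _))) (Vec.toList-map (map suc) _)) ⟩
    map toℕ (concat (map (map suc) (Vec.toList (Vec.tabulate (λ i → replicate (Vec.lookup t i) i)))))
      ≡⟨ cong (map toℕ) (concat-map (Vec.toList (Vec.tabulate (λ i → replicate (Vec.lookup t i) i)))) ⟩
    map toℕ (map suc (blockLabels t))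
      ≡⟨ trans (sym (map-∘ (blockLabels t))) (map-∘ (blockLabels t)) ⟩
    map suc (map toℕ (blockLabels t))
      ≡⟨ cong (map suc) (toℕ-blockLabels t) ⟩
    map suc (labels (toList t)) ∎))
  where open ≡-Reasoning

P≡gd : ∀ {n} (t : Vec ℕ n) → P t ≡ gd (toList t)
P≡gd {n} t = begin
  P t
    ≡⟨ length-filter≡sumOver (isGD? t) (allMaps N N) ⟩
  sumOver (indicator ∘ isGD? t) (allMaps N N)
    ≡⟨ sumOver-cong (λ σ → trans (indicator-⇔ (isGD? t σ) (good? σ) to from)
         (indicator-good ok? id [] σ (good? σ))) (allMaps N N) ⟩
  sumOver (weight ok? id []) (allMaps N N)
    ≡⟨ sumOver-weight ok? N id (allFin N) [] (++-identityʳ (allFin N)) ⟩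
  per (λ x y → indicator (ok? x y)) (allFin N) (allFin N)
    -- An entry depends only on the blocks of the two positions, so positions may be replaced by
    -- their labels.
    ≡⟨ per-map (toℕ ∘ block t) (toℕ ∘ block t) neq-block (allFin N) (allFin N) ⟨
  per neq (map (toℕ ∘ block t) (allFin N)) (map (toℕ ∘ block t) (allFin N))
    ≡⟨ cong₂ (per neq) blocks blocks ⟩
  gd (toList t) ∎
  where
  open ≡-Reasoning
  N = groundSize t
  ok? : ∀ x y → Dec (¬ block t y ≡ block t x)
  ok? x y = ¬? (block t y Fin.≟ block t x)
  to : ∀ {σ} → IsGD t σ → Good ok? id [] σ
  to (inj , der) = good (λ _ ()) (λ i j → All.tabulate⁻ (All.tabulate⁻ inj i) j) (All.tabulate⁻ der)
  from : ∀ {σ} → Good ok? id [] σ → IsGD t σ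
  from (good _ inj der) = All.tabulate⁺ (λ i → All.tabulate⁺ (inj i)) , All.tabulate⁺ der
  good? : ∀ σ → Dec (Good ok? id [] σ)
  good? σ = map′ to from (isGD? t σ)
  neq-block : ∀ x y → neq (toℕ (block t x)) (toℕ (block t y)) ≡ indicator (ok? x y)
  neq-block x y with block t y Fin.≟ block t x
  ... | yes e rewrite e = neq-refl (toℕ (block t x))
  ... | no ¬e = neq-≢ (¬e ∘ sym ∘ Fin.toℕ-injective)
  blocks : map (toℕ ∘ block t) (allFin N) ≡ labels (toList t)
  blocks = trans (map-∘ (allFin N))
    (trans (cong (map toℕ) (trans (map-tabulate id (block t)) (tabulate-lookup (blockLabels t))))
    (toℕ-blockLabels t))

theorem4p2 : (n : ℕ) (a b : Vec ℕ n) → Majorizes a b → P a ≤ P b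
theorem4p2 n a b maj = subst₂ _≤_ (sym (P≡gd a)) (sym (P≡gd b)) (gd-⊒ (Majorizes⇒⊒ a b maj))
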